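{- There is a constant $c_1>0$ such that for all $n>5$, $$h_3(n,\{(4,0),(4,2)\}) > c_1\, n^{1/5}.$$ That is, every $n$-vertex $3$-graph in which every four vertices span $1$, $3$ or $4$ edges has a clique or coclique of size greater than $c_1 n^{1/5}$.
   Context: For an $r$-uniform hypergraph ($r$-graph) $H$, a homogeneous set is a set of vertices that is either a clique (every $r$-subset is an edge) or a coclique (no $r$-subset is an edge); $h(H)$ denotes the size of a largest homogeneous set. An $(m,f)$-graph is an $r$-graph with $m$ vertices and $f$ edges; $H$ is $(m,f)$-free if it contains no induced sub-hypergraph that is an $(m,f)$-graph. For a set $Q$ of pairs $(m,f)$, $H$ is $Q$-free if it is $(m,f)$-free for every $(m,f)\in Q$. $h_r(n,Q)$ is the minimum of $h(H)$ over all $n$-vertex $Q$-free $r$-graphs $H$. -}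

module Defs where

import Algebra.Definitions.RawSemiring
open import Data.Bool using (Bool; T; T?)
open import Data.Fin.Subset using (Subset; inside; outside; ∣_∣; _⊆_)
open import Data.Fin.Subset.Properties using (_⊆?_)
open import Data.Integer using (+_)
open import Data.List using (List; []; _∷_; _++_; map; filter; length)
open import Data.Nat using (ℕ; zero; suc; _≤_)
open import Data.Product using (Σ; ∃-syntax; _×_; _,_)
open import Data.Rational using (ℚ; _/_; _*_; _<_; +-*-rawSemiring)
open import Data.Sum using (_⊎_)
open import Data.Vec using ([]; _∷_)
open import Level using (0ℓ)
open import Relation.Binary.PropositionalEquality using (_≡_)
open import Relation.Nullary using (¬_)
open import Relation.Nullary.Decidable using (_×-dec_)
open import Relation.Unary using (Pred; _∈_)

open Algebra.Definitions.RawSemiring +-*-rawSemiring using (_^_)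

IsMinimum IsMaximum : Pred ℕ 0ℓ → Pred ℕ 0ℓ
IsMinimum P k = P k × (∀ j → P j → k ≤ j)
IsMaximum P k = P k × (∀ j → P j → j ≤ k)

-- The edge set is given by its characteristic function, so that
-- membership and edge counts are decidable without classical axioms.
record Hypergraph (r n : ℕ) : Set where
  field
    isEdge  : Subset n → Bool
    uniform : ∀ e → T (isEdge e) → ∣ e ∣ ≡ r

  Edge : Pred (Subset n) 0ℓ
  Edge e = T (isEdge e)

open Hypergraph public

-- Every subset of Fin n, listed exactly once.
subsets : ∀ n → List (Subset n)
subsets zero    = [] ∷ []
subsets (suc n) = map (inside ∷_) (subsets n) ++ map (outside ∷_) (subsets n)

module _ {r n : ℕ} (H : Hypergraph r n) where

  IsClique IsCoclique IsHomogeneous : Pred (Subset n) 0ℓ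
  IsClique      S = ∀ e → ∣ e ∣ ≡ r → e ⊆ S → Edge H e
  IsCoclique    S = ∀ e → ∣ e ∣ ≡ r → e ⊆ S → ¬ Edge H e
  IsHomogeneous S = IsClique S ⊎ IsCoclique S

  -- The edges of the sub-hypergraph induced on S.
  inducedEdges : Subset n → List (Subset n)
  inducedEdges S = filter (λ e → T? (isEdge H e) ×-dec (e ⊆? S)) (subsets n)

  IsFree : ℕ → ℕ → Set
  IsFree m f = ¬ (∃[ S ] (∣ S ∣ ≡ m × length (inducedEdges S) ≡ f))

  IsQFree : Pred (ℕ × ℕ) 0ℓ → Set
  IsQFree Q = ∀ m f → (m , f) ∈ Q → IsFree m f

  -- h(H) = k
  HomogeneousNumber : Pred ℕ 0ℓ
  HomogeneousNumber = IsMaximum (λ k → ∃[ S ] (IsHomogeneous S × ∣ S ∣ ≡ k))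

-- h_r(n, Q) = k.  No k satisfies this when there is no Q-free r-graph
-- on n vertices, so uses should assert that k exists.
MinHomogeneousNumber : (r n : ℕ) → Pred (ℕ × ℕ) 0ℓ → Pred ℕ 0ℓ
MinHomogeneousNumber r n Q =
  IsMinimum (λ k → Σ (Hypergraph r n) λ H → IsQFree H Q × HomogeneousNumber H k)

fromℕ : ℕ → ℚ
fromℕ n = + n / 1

-- c · n^(1/5) < k, for c ≥ 0.  The real fifth root is eliminated by raising
-- both (nonnegative) sides to the fifth power, which is strictly monotone.
_·⁵√_≺_ : ℚ → ℕ → ℕ → Set
c ·⁵√ n ≺ k = c ^ 5 * fromℕ n < fromℕ k ^ 5

{-# OPTIONS --safe #-}
module Submission where

-- On five vertices every triple lies in exactly two quadruples, so the edge
-- counts of the five quadruples have even sum.  A quadruple containing a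
-- non-edge spans 1 or 3 edges, an odd number; hence the five quadruples cannot
-- all contain a non-edge.  Consequently, for any two vertices u and v, the set
-- N(u,v) of all p for which puv is a non-edge is a clique: a non-edge pqr
-- inside it would put a non-edge into every quadruple of {p,q,r,u,v}.
-- Now let S be a clique of maximum size.  A vertex x outside S forms a non-edge
-- with some a, b in S, so x lies in N(a,b).  Hence the vertex set is covered by
-- S and the cliques N(a,b), and n ≤ k + k³ where k is the homogeneous number.
-- This gives n < 32 k⁵, that is, c₁ = ½.

open import Defs
import Algebra.Definitions.RawSemiring
open import Data.Bool using (Bool; true; false; T; T?; _xor_)
open import Data.Bool.Properties using (T-≡)
open import Data.Bool.Solver using (module xor-∧-Solver)
open import Data.Fin using (Fin; zero; suc)
import Data.Fin.Properties as Fin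
open import Data.Fin.Subset
  using (Subset; inside; outside; ∣_∣; _∈_; _∉_; _⊆_; _-_; ⁅_⁆; ⋃; ⊥; ⊤; Nonempty)
  renaming (_∪_ to _∪ˢ_)
open import Data.Fin.Subset.Properties
import Data.Integer as ℤ
import Data.Integer.Properties as ℤ
open import Data.List using (List; []; _∷_; _++_; foldr; map; filter; length; cartesianProduct)
import Data.List.Properties as List
open import Data.List.Membership.Propositional using () renaming (_∈_ to _∈ˡ_)
open import Data.List.Membership.Propositional.Properties
  using (∈-map⁺; ∈-map⁻; ∈-++⁺ˡ; ∈-++⁺ʳ; ∈-++⁻; ∈-filter⁺; ∈-filter⁻; ∈-cartesianProduct⁺)
open import Data.List.Membership.Propositional.Properties.WithK using (unique∧set⇒bag)
open import Data.List.Relation.Binary.BagAndSetEquality using (∼bag⇒↭)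
open import Data.List.Relation.Binary.Permutation.Propositional.Properties using (↭-length)
open import Data.List.Relation.Unary.All using (All; []; _∷_)
import Data.List.Relation.Unary.All as All
import Data.List.Relation.Unary.All.Properties as All
open import Data.List.Relation.Unary.AllPairs using ([]; _∷_)
open import Data.List.Relation.Unary.Any using (here; there)
import Data.List.Relation.Unary.Unique.DecPropositional as DecUnique
open import Data.List.Relation.Unary.Unique.Propositional using (Unique)
import Data.List.Relation.Unary.Unique.Propositional.Properties as Unique
open import Data.Nat using (ℕ; zero; suc; _>_; _≤_; z≤n; s≤s; _+_; _^_)
import Data.Nat as ℕ
import Data.Nat.Properties as ℕ
open import Data.Product using (Σ; ∃; ∃-syntax; _×_; _,_; proj₁; proj₂; uncurry)
open import Data.Rational using (ℚ; 0ℚ; ½; _<_; toℚᵘ)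
import Data.Rational as ℚ
import Data.Rational.Properties as ℚ
open import Data.Rational.Unnormalised using (mkℚᵘ; *<*)
import Data.Rational.Unnormalised as ℚᵘ
import Data.Rational.Unnormalised.Properties as ℚᵘ
open import Data.Sum using (_⊎_; inj₁; inj₂)
open import Data.Vec using ([]; _∷_; tabulate; here; there)
open import Data.Vec.Properties using (lookup∘tabulate; []=⇒lookup; lookup⇒[]=; ∷-injectiveʳ)
open import Function using (_∘_; mk⇔; Equivalence)
open import Level using (0ℓ)
open import Relation.Binary.PropositionalEquality
  using (_≡_; _≢_; _≗_; refl; sym; trans; cong; cong₂; subst; subst₂; ≢-sym)
open import Relation.Nullary using (¬_; Dec; yes; no; contradiction)
open import Relation.Nullary.Decidable
  using (⌊_⌋; map′; ¬?; _×-dec_; _⊎-dec_; _→-dec_; decidable-stable; toWitness; fromWitness)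
open import Relation.Unary using (Pred; Decidable; ｛_｝; _∪_)

private variable
  n r : ℕ

-- Finite sets as lists

∈-⋃⁺ : ∀ {x : Fin n} {p ps} → p ∈ˡ ps → x ∈ p → x ∈ ⋃ ps
∈-⋃⁺ (here refl) x∈p = x∈p∪q⁺ (inj₁ x∈p)
∈-⋃⁺ (there p∈ps) x∈p = x∈p∪q⁺ (inj₂ (∈-⋃⁺ p∈ps x∈p))

∣⁅x⁆∪p∣≡1+∣p∣ : ∀ (x : Fin n) p → x ∉ p → ∣ ⁅ x ⁆ ∪ˢ p ∣ ≡ suc ∣ p ∣
∣⁅x⁆∪p∣≡1+∣p∣ zero (inside ∷ p) x∉p = contradiction here x∉p
∣⁅x⁆∪p∣≡1+∣p∣ zero (outside ∷ p) x∉p = cong (suc ∘ ∣_∣) (∪-identityˡ p)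
∣⁅x⁆∪p∣≡1+∣p∣ (suc x) (inside ∷ p) x∉p = cong suc (∣⁅x⁆∪p∣≡1+∣p∣ x p (x∉p ∘ there))
∣⁅x⁆∪p∣≡1+∣p∣ (suc x) (outside ∷ p) x∉p = ∣⁅x⁆∪p∣≡1+∣p∣ x p (x∉p ∘ there)

opaque
  -- Opaque, so that everything outside reaches such a set only through the facts proved in this
  -- block; the last two of them export its defining equations.
  ⟦_⟧ : List (Fin n) → Subset n
  ⟦ xs ⟧ = ⋃ (map ⁅_⁆ xs)

  ∈-⟦⟧⁺ : ∀ {x : Fin n} {xs} → x ∈ˡ xs → x ∈ ⟦ xs ⟧
  ∈-⟦⟧⁺ {x = x} x∈xs = ∈-⋃⁺ (∈-map⁺ ⁅_⁆ x∈xs) (x∈⁅x⁆ x)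

  ∈-⟦⟧⁻ : ∀ {x : Fin n} xs → x ∈ ⟦ xs ⟧ → x ∈ˡ xs
  ∈-⟦⟧⁻ [] x∈ = contradiction x∈ ∉⊥
  ∈-⟦⟧⁻ (y ∷ xs) x∈ with x∈p∪q⁻ ⁅ y ⁆ ⟦ xs ⟧ x∈
  ... | inj₁ x∈y = here (x∈⁅y⁆⇒x≡y y x∈y)
  ... | inj₂ x∈xs = there (∈-⟦⟧⁻ xs x∈xs)

  ∣⟦x∷xs⟧∣ : ∀ {x : Fin n} {xs} → x ∉ ⟦ xs ⟧ → ∣ ⟦ x ∷ xs ⟧ ∣ ≡ suc ∣ ⟦ xs ⟧ ∣
  ∣⟦x∷xs⟧∣ = ∣⁅x⁆∪p∣≡1+∣p∣ _ _

  ⟦[]⟧ : ⟦ [] ⟧ ≡ ⊥ {n}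
  ⟦[]⟧ = refl

  ⟦x∷xs⟧ : ∀ (x : Fin n) xs → ⟦ x ∷ xs ⟧ ≡ ⁅ x ⁆ ∪ˢ ⟦ xs ⟧
  ⟦x∷xs⟧ x xs = refl

∣⟦⟧∣ : ∀ {xs : List (Fin n)} → Unique xs → ∣ ⟦ xs ⟧ ∣ ≡ length xs
∣⟦⟧∣ {n} [] = trans (cong ∣_∣ ⟦[]⟧) (∣⊥∣≡0 n)
∣⟦⟧∣ {xs = x ∷ xs} xxs@(_ ∷ !xs) =
  trans (∣⟦x∷xs⟧∣ (Unique.Unique[x∷xs]⇒x∉xs xxs ∘ ∈-⟦⟧⁻ xs)) (cong suc (∣⟦⟧∣ !xs))

-- An element of `q` missing from `p` would make the inclusion strict and hence `q` strictly larger.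
⊆∧∣∣≤⇒≡ : ∀ {p q : Subset n} → p ⊆ q → ∣ q ∣ ≤ ∣ p ∣ → p ≡ q
⊆∧∣∣≤⇒≡ {p = p} p⊆q ∣q∣≤∣p∣ = ⊆-antisym p⊆q λ {x} x∈q →
  decidable-stable (x ∈? p) λ x∉p → ℕ.<⇒≱ (p⊂q⇒∣p∣<∣q∣ (p⊆q , x , x∈q , x∉p)) ∣q∣≤∣p∣

x∉p-x : ∀ (x : Fin n) p → x ∉ p - x
x∉p-x zero (s ∷ p) ()
x∉p-x (suc x) (s ∷ p) (there x∈) = x∉p-x x p x∈

⁅x⁆∪p-x≡p : ∀ {x : Fin n} {p} → x ∈ p → ⁅ x ⁆ ∪ˢ (p - x) ≡ p
⁅x⁆∪p-x≡p {x = x} {p} x∈p = ⊆-antisym ⊆p p⊆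
  where
  ⊆p : ⁅ x ⁆ ∪ˢ (p - x) ⊆ p
  ⊆p y∈ with x∈p∪q⁻ ⁅ x ⁆ (p - x) y∈
  ... | inj₁ y∈x = subst (_∈ p) (sym (x∈⁅y⁆⇒x≡y x y∈x)) x∈p
  ... | inj₂ y∈p-x = p─q⊆p p ⁅ x ⁆ y∈p-x

  p⊆ : p ⊆ ⁅ x ⁆ ∪ˢ (p - x)
  p⊆ {y} y∈p with y Fin.≟ x
  ... | yes refl = x∈p∪q⁺ (inj₁ (x∈⁅x⁆ x))
  ... | no y≢x = x∈p∪q⁺ (inj₂ (x∈p∧x≢y⇒x∈p-y y∈p y≢x))

∣p-x∣ : ∀ {x : Fin n} {p k} → x ∈ p → ∣ p ∣ ≡ suc k → ∣ p - x ∣ ≡ k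
∣p-x∣ {x = x} {p} x∈p ∣p∣≡ = ℕ.suc-injective
  (trans (sym (∣⁅x⁆∪p∣≡1+∣p∣ x (p - x) (x∉p-x x p))) (trans (cong ∣_∣ (⁅x⁆∪p-x≡p x∈p)) ∣p∣≡))

∣p∣>0⇒Nonempty : ∀ {p : Subset n} {k} → ∣ p ∣ ≡ suc k → Nonempty p
∣p∣>0⇒Nonempty {n} {p} ∣p∣≡ with nonempty? p
... | yes ne = ne
... | no empty with () ← trans (sym ∣p∣≡) (trans (cong ∣_∣ (Empty-unique empty)) (∣⊥∣≡0 n))

opaque
  enumerate : ∀ k (p : Subset n) → ∣ p ∣ ≡ k → ∃[ xs ] (length xs ≡ k × Unique xs × p ≡ ⟦ xs ⟧)
  -- Lets the caller choose the head of the list. The covering argument lists a non-edge with the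
  -- new vertex first.
  enumerateFrom : ∀ {x : Fin n} {p k} → x ∈ p → ∣ p ∣ ≡ suc k →
    ∃[ xs ] (length xs ≡ k × Unique (x ∷ xs) × p ≡ ⟦ x ∷ xs ⟧)

  enumerate zero p ∣p∣≡0 = [] , refl , [] , trans (Empty-unique λ (x , x∈p) →
    ℕ.n≮0 (subst (∣ p - x ∣ ℕ.<_) ∣p∣≡0 (x∈p⇒∣p-x∣<∣p∣ x∈p))) (sym ⟦[]⟧)
  enumerate (suc k) p ∣p∣≡ with x , x∈p ← ∣p∣>0⇒Nonempty {p = p} ∣p∣≡
    with xs , len , !xs , p≡ ← enumerateFrom x∈p ∣p∣≡ = x ∷ xs , cong suc len , !xs , p≡

  enumerateFrom {x = x} {p} {k} x∈p ∣p∣≡ with xs , len , !xs , eq ← enumerate k (p - x) (∣p-x∣ x∈p ∣p∣≡) =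
    xs , len
    , All.tabulate (λ { y∈xs refl → x∉p-x x p (subst (x ∈_) (sym eq) (∈-⟦⟧⁺ y∈xs)) }) ∷ !xs
    , trans (sym (⁅x⁆∪p-x≡p x∈p)) (trans (cong (⁅ x ⁆ ∪ˢ_) eq) (sym (⟦x∷xs⟧ x xs)))

∣p∪q∣≤∣p∣+∣q∣ : ∀ (p q : Subset n) → ∣ p ∪ˢ q ∣ ≤ ∣ p ∣ + ∣ q ∣
∣p∪q∣≤∣p∣+∣q∣ [] [] = z≤n
∣p∪q∣≤∣p∣+∣q∣ (inside ∷ p) (t ∷ q) =
  s≤s (ℕ.≤-trans (∣p∪q∣≤∣p∣+∣q∣ p q) (ℕ.+-monoʳ-≤ ∣ p ∣ (∣p∣≤∣x∷p∣ t q)))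
∣p∪q∣≤∣p∣+∣q∣ (outside ∷ p) (inside ∷ q) =
  ℕ.≤-trans (s≤s (∣p∪q∣≤∣p∣+∣q∣ p q)) (ℕ.≤-reflexive (sym (ℕ.+-suc ∣ p ∣ ∣ q ∣)))
∣p∪q∣≤∣p∣+∣q∣ (outside ∷ p) (outside ∷ q) = ∣p∪q∣≤∣p∣+∣q∣ p q

length-cartesianProduct : ∀ {A B : Set} (xs : List A) (ys : List B) →
  length (cartesianProduct xs ys) ≡ length xs ℕ.* length ys
length-cartesianProduct [] ys = refl
length-cartesianProduct (x ∷ xs) ys = trans (List.length-++ (map (x ,_) ys))
  (cong₂ _+_ (List.length-map (x ,_) ys) (length-cartesianProduct xs ys))

∣⋃∣≤ : ∀ {ps : List (Subset n)} {m} → All (λ p → ∣ p ∣ ≤ m) ps → ∣ ⋃ ps ∣ ≤ length ps ℕ.* m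
∣⋃∣≤ {n} [] = ℕ.≤-reflexive (∣⊥∣≡0 n)
∣⋃∣≤ {ps = p ∷ ps} (p≤ ∷ ps≤) = ℕ.≤-trans (∣p∪q∣≤∣p∣+∣q∣ p (⋃ ps)) (ℕ.+-mono-≤ p≤ (∣⋃∣≤ ps≤))

comprehension : ∀ {P : Pred (Fin n) 0ℓ} → Decidable P → Subset n
comprehension P? = tabulate (λ x → ⌊ P? x ⌋)

∈-comprehension⁺ : ∀ {P : Pred (Fin n) 0ℓ} (P? : Decidable P) {x} → P x → x ∈ comprehension P?
∈-comprehension⁺ P? {x} px =
  lookup⇒[]= x _ (trans (lookup∘tabulate _ x) (Equivalence.to T-≡ (fromWitness px)))

∈-comprehension⁻ : ∀ {P : Pred (Fin n) 0ℓ} (P? : Decidable P) {x} → x ∈ comprehension P? → P x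
∈-comprehension⁻ P? {x} x∈ =
  toWitness {a? = P? x} (Equivalence.from T-≡ (trans (sym (lookup∘tabulate _ x)) ([]=⇒lookup x∈)))

-- Counting the edges inside a set of four vertices

∈-subsets : ∀ (p : Subset n) → p ∈ˡ subsets n
∈-subsets [] = here refl
∈-subsets (inside ∷ p) = ∈-++⁺ˡ (∈-map⁺ (inside ∷_) (∈-subsets p))
∈-subsets {suc n} (outside ∷ p) = ∈-++⁺ʳ (map (inside ∷_) (subsets n)) (∈-map⁺ (outside ∷_) (∈-subsets p))

subsets-unique : ∀ n → Unique (subsets n)
subsets-unique zero = [] ∷ []
subsets-unique (suc n) = Unique.++⁺
  (Unique.map⁺ ∷-injectiveʳ (subsets-unique n))
  (Unique.map⁺ ∷-injectiveʳ (subsets-unique n))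
  λ (∈in , ∈out) → disjoint (∈-map⁻ (inside ∷_) ∈in) (∈-map⁻ (outside ∷_) ∈out)
  where
  disjoint : ∀ {p} → ∃[ q ] (q ∈ˡ subsets n × p ≡ inside ∷ q) →
    ¬ (∃[ q ] (q ∈ˡ subsets n × p ≡ outside ∷ q))
  disjoint (_ , _ , refl) (_ , _ , ())

⟦⟧-≢ : ∀ {x : Fin n} {xs ys} → x ∈ˡ xs → All (x ≢_) ys → ⟦ xs ⟧ ≢ ⟦ ys ⟧
⟦⟧-≢ {ys = ys} x∈xs x∉ys eq =
  All.lookup x∉ys (∈-⟦⟧⁻ ys (subst (_ ∈_) eq (∈-⟦⟧⁺ x∈xs))) refl

-- The split `xs ++ x ∷ ys` allows an omission at any position while the order of the remaining
-- vertices is kept.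
⊆-omit : ∀ (xs : List (Fin n)) {ys x p} → x ∉ p → p ⊆ ⟦ xs ++ x ∷ ys ⟧ → p ⊆ ⟦ xs ++ ys ⟧
⊆-omit xs {ys} {x} x∉p p⊆ y∈p with ∈-++⁻ xs (∈-⟦⟧⁻ (xs ++ x ∷ ys) (p⊆ y∈p))
... | inj₁ y∈xs = ∈-⟦⟧⁺ (∈-++⁺ˡ y∈xs)
... | inj₂ (here refl) = contradiction y∈p x∉p
... | inj₂ (there y∈ys) = ∈-⟦⟧⁺ (∈-++⁺ʳ xs y∈ys)

Unique-omit : ∀ (xs : List (Fin n)) {x ys} → Unique (xs ++ x ∷ ys) → Unique (xs ++ ys)
Unique-omit [] (_ ∷ !ys) = !ys
Unique-omit (z ∷ xs) (z∉ ∷ !xs) with z∉xs , _ ∷ z∉ys ← All.++⁻ xs z∉ =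
  All.++⁺ z∉xs z∉ys ∷ Unique-omit xs !xs

⟦⟧-omit-⊆ : ∀ (xs : List (Fin n)) {x ys} → ⟦ xs ++ ys ⟧ ⊆ ⟦ xs ++ x ∷ ys ⟧
⟦⟧-omit-⊆ xs {x} {ys} y∈ with ∈-++⁻ xs (∈-⟦⟧⁻ (xs ++ ys) y∈)
... | inj₁ y∈xs = ∈-⟦⟧⁺ (∈-++⁺ˡ y∈xs)
... | inj₂ y∈ys = ∈-⟦⟧⁺ (∈-++⁺ʳ xs (there y∈ys))

-- The i-th entry omits the i-th vertex and keeps the order of the others. A triple common to two
-- quadruples listed in the same order is thus the same term in both, which the parity identity on
-- five vertices relies on.
triples : (a b c d : Fin n) → List (Subset n)
triples a b c d =
  ⟦ b ∷ c ∷ d ∷ [] ⟧ ∷ ⟦ a ∷ c ∷ d ∷ [] ⟧ ∷ ⟦ a ∷ b ∷ d ∷ [] ⟧ ∷ ⟦ a ∷ b ∷ c ∷ [] ⟧ ∷ []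

module _ {a b c d : Fin n} where

  -- Of two entries, the earlier contains the vertex that the later omits.
  triples-unique : Unique (a ∷ b ∷ c ∷ d ∷ []) → Unique (triples a b c d)
  triples-unique ((a≢b ∷ a≢c ∷ a≢d ∷ []) ∷ (b≢c ∷ b≢d ∷ []) ∷ (c≢d ∷ []) ∷ _) =
      (⟦⟧-≢ (here refl) b∉acd ∷ ⟦⟧-≢ (there (here refl)) c∉abd ∷ ⟦⟧-≢ (there (there (here refl))) d∉abc ∷ [])
    ∷ (⟦⟧-≢ (there (here refl)) c∉abd ∷ ⟦⟧-≢ (there (there (here refl))) d∉abc ∷ [])
    ∷ (⟦⟧-≢ (there (there (here refl))) d∉abc ∷ [])
    ∷ [] ∷ []
    where
    b∉acd : All (b ≢_) (a ∷ c ∷ d ∷ [])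
    b∉acd = ≢-sym a≢b ∷ b≢c ∷ b≢d ∷ []
    c∉abd : All (c ≢_) (a ∷ b ∷ d ∷ [])
    c∉abd = ≢-sym a≢c ∷ ≢-sym b≢c ∷ c≢d ∷ []
    d∉abc : All (d ≢_) (a ∷ b ∷ c ∷ [])
    d∉abc = ≢-sym a≢d ∷ ≢-sym b≢d ∷ ≢-sym c≢d ∷ []

  module _ (unique : Unique (a ∷ b ∷ c ∷ d ∷ [])) where

    private
      omit : ∀ (xs : List (Fin n)) {x ys} → Unique (xs ++ x ∷ ys) →
        ∣ ⟦ xs ++ ys ⟧ ∣ ≡ length (xs ++ ys) × ⟦ xs ++ ys ⟧ ⊆ ⟦ xs ++ x ∷ ys ⟧
      omit xs !xs = ∣⟦⟧∣ (Unique-omit xs !xs) , ⟦⟧-omit-⊆ xs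

    ∈-triples⁻ : ∀ {e} → e ∈ˡ triples a b c d → ∣ e ∣ ≡ 3 × e ⊆ ⟦ a ∷ b ∷ c ∷ d ∷ [] ⟧
    ∈-triples⁻ (here refl) = omit [] unique
    ∈-triples⁻ (there (here refl)) = omit (a ∷ []) unique
    ∈-triples⁻ (there (there (here refl))) = omit (a ∷ b ∷ []) unique
    ∈-triples⁻ (there (there (there (here refl)))) = omit (a ∷ b ∷ c ∷ []) unique

    -- A set of size 3 cannot contain all four vertices. It therefore lies inside the triple
    -- omitting a missing one, and equals that triple because the sizes agree.
    ∈-triples⁺ : ∀ {e} → ∣ e ∣ ≡ 3 → e ⊆ ⟦ a ∷ b ∷ c ∷ d ∷ [] ⟧ → e ∈ˡ triples a b c d
    ∈-triples⁺ {e} ∣e∣≡3 e⊆ = cases (a ∈? e) (b ∈? e) (c ∈? e) (d ∈? e)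
      where
      fill : ∀ {t} → t ∈ˡ triples a b c d → e ⊆ t → e ∈ˡ triples a b c d
      fill t∈ e⊆t = subst (_∈ˡ triples a b c d)
        (sym (⊆∧∣∣≤⇒≡ e⊆t (ℕ.≤-reflexive (trans (proj₁ (∈-triples⁻ t∈)) (sym ∣e∣≡3))))) t∈

      cases : Dec (a ∈ e) → Dec (b ∈ e) → Dec (c ∈ e) → Dec (d ∈ e) → e ∈ˡ triples a b c d
      cases (no a∉e) _ _ _ = fill (here refl) (⊆-omit [] a∉e e⊆)
      cases _ (no b∉e) _ _ = fill (there (here refl)) (⊆-omit (a ∷ []) b∉e e⊆)
      cases _ _ (no c∉e) _ = fill (there (there (here refl))) (⊆-omit (a ∷ b ∷ []) c∉e e⊆)
      cases _ _ _ (no d∉e) = fill (there (there (there (here refl)))) (⊆-omit (a ∷ b ∷ c ∷ []) d∉e e⊆)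
      cases (yes a∈e) (yes b∈e) (yes c∈e) (yes d∈e) = contradiction
        (subst₂ _≤_ (∣⟦⟧∣ unique) ∣e∣≡3 (p⊆q⇒∣p∣≤∣q∣ λ x∈ →
          All.lookup (a∈e ∷ b∈e ∷ c∈e ∷ d∈e ∷ []) (∈-⟦⟧⁻ _ x∈)))
        λ { (s≤s (s≤s (s≤s ()))) }

    module _ (H : Hypergraph 3 n) where

      private
        edge? : Decidable (Edge H)
        edge? = T? ∘ isEdge H

        induced? : Decidable (λ e → Edge H e × e ⊆ ⟦ a ∷ b ∷ c ∷ d ∷ [] ⟧)
        induced? e = T? (isEdge H e) ×-dec (e ⊆? ⟦ a ∷ b ∷ c ∷ d ∷ [] ⟧)

        to : ∀ {e} → e ∈ˡ filter induced? (subsets n) → e ∈ˡ filter edge? (triples a b c d)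
        to {e} e∈ with _ , edge , e⊆ ← ∈-filter⁻ induced? {xs = subsets n} e∈ =
          ∈-filter⁺ edge? (∈-triples⁺ (uniform H e edge) e⊆) edge

        from : ∀ {e} → e ∈ˡ filter edge? (triples a b c d) → e ∈ˡ filter induced? (subsets n)
        from {e} e∈ with e∈triples , edge ← ∈-filter⁻ edge? {xs = triples a b c d} e∈
          with _ , e⊆ ← ∈-triples⁻ e∈triples = ∈-filter⁺ induced? (∈-subsets e) (edge , e⊆)

      -- Both lists are free of duplicates and have the same members, so one is a permutation of the
      -- other. Uniformity of `H` supplies the size 3 of an induced edge.
      length-inducedEdges :
        length (inducedEdges H ⟦ a ∷ b ∷ c ∷ d ∷ [] ⟧) ≡ length (filter edge? (triples a b c d))
      length-inducedEdges = ↭-length {xs = filter induced? (subsets n)} {ys = filter edge? (triples a b c d)}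
        (∼bag⇒↭ (unique∧set⇒bag
          (Unique.filter⁺ induced? (subsets-unique n))
          (Unique.filter⁺ edge? (triples-unique unique))
          (mk⇔ to from)))

-- 3-graphs without (4,0) and (4,2)

parity : List Bool → Bool
parity = foldr _xor_ false

length-filter-T : ∀ {A : Set} (f : A → Bool) xs →
  length (filter (T? ∘ f) xs) ≡ length (filter T? (map f xs))
length-filter-T f [] = refl
length-filter-T f (x ∷ xs) with f x
... | true = cong suc (length-filter-T f xs)
... | false = length-filter-T f xs

-- Exclusion of the count 4 is phrased as `¬ All T ws`, the form in which a non-edge in the
-- quadruple provides it.
≢0∧≢2∧≢4⇒odd : ∀ w x y z → let ws = w ∷ x ∷ y ∷ z ∷ [] in
  length (filter T? ws) ≢ 0 → length (filter T? ws) ≢ 2 → ¬ All T ws → parity ws ≡ true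
≢0∧≢2∧≢4⇒odd true true true true _ _ ¬all = contradiction (_ ∷ _ ∷ _ ∷ _ ∷ []) ¬all
≢0∧≢2∧≢4⇒odd true true true false _ _ _ = refl
≢0∧≢2∧≢4⇒odd true true false true _ _ _ = refl
≢0∧≢2∧≢4⇒odd true true false false _ ≢2 _ = contradiction refl ≢2
≢0∧≢2∧≢4⇒odd true false true true _ _ _ = refl
≢0∧≢2∧≢4⇒odd true false true false _ ≢2 _ = contradiction refl ≢2
≢0∧≢2∧≢4⇒odd true false false true _ ≢2 _ = contradiction refl ≢2
≢0∧≢2∧≢4⇒odd true false false false _ _ _ = refl
≢0∧≢2∧≢4⇒odd false true true true _ _ _ = refl
≢0∧≢2∧≢4⇒odd false true true false _ ≢2 _ = contradiction refl ≢2
≢0∧≢2∧≢4⇒odd false true false true _ ≢2 _ = contradiction refl ≢2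
≢0∧≢2∧≢4⇒odd false true false false _ _ _ = refl
≢0∧≢2∧≢4⇒odd false false true true _ ≢2 _ = contradiction refl ≢2
≢0∧≢2∧≢4⇒odd false false true false _ _ _ = refl
≢0∧≢2∧≢4⇒odd false false false true _ _ _ = refl
≢0∧≢2∧≢4⇒odd false false false false ≢0 _ _ = contradiction refl ≢0

-- Decidability of homogeneous sets and existence of extremal values

allSubsets? : ∀ {P : Pred (Subset n) 0ℓ} → Decidable P → Dec (∀ p → P p)
allSubsets? P? = map′
  (λ ¬∃ p → decidable-stable (P? p) λ ¬Pp → ¬∃ (p , ¬Pp))
  (λ ∀P (p , ¬Pp) → ¬Pp (∀P p))
  (¬? (anySubset? (¬? ∘ P?)))

module _ (H : Hypergraph r n) where

  isClique? : Decidable (IsClique H)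
  isClique? S = allSubsets? λ e → (∣ e ∣ ℕ.≟ r) →-dec (e ⊆? S) →-dec T? (isEdge H e)

  isCoclique? : Decidable (IsCoclique H)
  isCoclique? S = allSubsets? λ e → (∣ e ∣ ℕ.≟ r) →-dec (e ⊆? S) →-dec ¬? (T? (isEdge H e))

  opaque
    -- The negated universal statement yields a witness constructively, since the search over all
    -- subsets is finite and each condition is decidable.
    ¬clique⇒nonEdge : ∀ {S} → ¬ IsClique H S → ∃[ e ] (∣ e ∣ ≡ r × e ⊆ S × ¬ Edge H e)
    ¬clique⇒nonEdge {S} ¬clique = decidable-stable
      (anySubset? λ e → (∣ e ∣ ℕ.≟ r) ×-dec (e ⊆? S) ×-dec ¬? (T? (isEdge H e)))
      λ ¬∃ → ¬clique λ e ∣e∣≡r e⊆S →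
        decidable-stable (T? (isEdge H e)) λ ¬edge → ¬∃ (e , ∣e∣≡r , e⊆S , ¬edge)

  HasClique HasHomogeneous : Pred ℕ 0ℓ
  HasClique k = ∃[ S ] (IsClique H S × ∣ S ∣ ≡ k)
  HasHomogeneous k = ∃[ S ] (IsHomogeneous H S × ∣ S ∣ ≡ k)

  hasClique? : Decidable HasClique
  hasClique? k = anySubset? λ S → isClique? S ×-dec (∣ S ∣ ℕ.≟ k)

  hasHomogeneous? : Decidable HasHomogeneous
  hasHomogeneous? k = anySubset? λ S → (isClique? S ⊎-dec isCoclique? S) ×-dec (∣ S ∣ ℕ.≟ k)

minimum : ∀ {P : Pred ℕ 0ℓ} → Decidable P → ∀ m → P m → ∃ (IsMinimum P)
minimum P? zero P0 = 0 , P0 , λ _ _ → z≤n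
minimum {P} P? (suc m) Psm with P? 0
... | yes P0 = 0 , P0 , λ _ _ → z≤n
... | no ¬P0 with k , Psk , least ← minimum (P? ∘ suc) m Psm =
  suc k , Psk , λ { zero P0 → contradiction P0 ¬P0 ; (suc j) Psj → s≤s (least j Psj) }

-- A downward search from the bound `m`; `P 0` ensures that it succeeds.
maximum : ∀ {P : Pred ℕ 0ℓ} → Decidable P → P 0 → ∀ m → (∀ j → P j → j ≤ m) → ∃ (IsMaximum P)
maximum P? P0 zero bounded = 0 , P0 , bounded
maximum P? P0 (suc m) bounded with P? (suc m)
... | yes Psm = suc m , Psm , bounded
... | no ¬Psm = maximum P? P0 m λ j Pj →
  ℕ.≤-pred (ℕ.≤∧≢⇒< (bounded j Pj) λ { refl → ¬Psm Pj })

maximum-unique : ∀ {P : Pred ℕ 0ℓ} {k l} → IsMaximum P k → IsMaximum P l → k ≡ l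
maximum-unique (Pk , k-max) (Pl , l-max) = ℕ.≤-antisym (l-max _ Pk) (k-max _ Pl)

module _ (H : Hypergraph (suc r) n) where

  -- Sets of size `suc r` are nonempty, so none lies inside `⊥`. For uniformity 0 the empty set
  -- would itself have to be an edge.
  ⊥-clique : IsClique H ⊥
  ⊥-clique e ∣e∣≡ e⊆⊥ with x , x∈e ← ∣p∣>0⇒Nonempty {p = e} ∣e∣≡ = contradiction (e⊆⊥ x∈e) ∉⊥

  opaque
    maximumClique : ∃ (IsMaximum (HasClique H))
    maximumClique = maximum (hasClique? H) (⊥ , ⊥-clique , ∣⊥∣≡0 n) n λ { _ (S , _ , refl) → ∣p∣≤n S }

    homogeneousNumber : ∃ (HomogeneousNumber H)
    homogeneousNumber =
      maximum (hasHomogeneous? H) (⊥ , inj₁ ⊥-clique , ∣⊥∣≡0 n) n λ { _ (S , _ , refl) → ∣p∣≤n S }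

-- Non-edge links are cliques and cover the vertices

module _ (H : Hypergraph 3 n) (free₀ : IsFree H 4 0) (free₂ : IsFree H 4 2) where

  quadParity : (a b c d : Fin n) → Bool
  quadParity a b c d = parity (map (isEdge H) (triples a b c d))

  -- Freeness excludes 0 and 2 edges, and the non-edge excludes 4.
  quad-odd : ∀ {a b c d} → Unique (a ∷ b ∷ c ∷ d ∷ []) →
    ¬ All (Edge H) (triples a b c d) → quadParity a b c d ≡ true
  quad-odd {a} {b} {c} {d} unique ¬all = ≢0∧≢2∧≢4⇒odd _ _ _ _
    (λ none → free₀ (⟦ a ∷ b ∷ c ∷ d ∷ [] ⟧ , ∣⟦⟧∣ unique , trans length≡ none))
    (λ two → free₂ (⟦ a ∷ b ∷ c ∷ d ∷ [] ⟧ , ∣⟦⟧∣ unique , trans length≡ two))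
    (¬all ∘ All.map⁻)
    where
    length≡ : length (inducedEdges H ⟦ a ∷ b ∷ c ∷ d ∷ [] ⟧) ≡
      length (filter T? (map (isEdge H) (triples a b c d)))
    length≡ = trans (length-inducedEdges unique H) (length-filter-T (isEdge H) (triples a b c d))

  quadParities : (a b c d e : Fin n) → List Bool
  quadParities a b c d e =
    quadParity b c d e ∷ quadParity a c d e ∷ quadParity a b d e ∷ quadParity a b c e ∷ quadParity a b c d ∷ []

  -- Each of the ten triples occurs in exactly two of the five quadruples and cancels under xor. The
  -- five rows given to the solver are bcde, acde, abde, abce and abcd, each in the order of
  -- `triples`.
  quadParity-sum : ∀ a b c d e → parity (quadParities a b c d e) ≡ false
  quadParity-sum a b c d e = solve 10
    (λ abc abd abe acd ace ade bcd bce bde cde →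
      (cde :+ (bde :+ (bce :+ (bcd :+ con false)))) :+
      ((cde :+ (ade :+ (ace :+ (acd :+ con false)))) :+
      ((bde :+ (ade :+ (abe :+ (abd :+ con false)))) :+
      ((bce :+ (ace :+ (abe :+ (abc :+ con false)))) :+
      ((bcd :+ (acd :+ (abd :+ (abc :+ con false)))) :+ con false)))) := con false) refl
    (t a b c) (t a b d) (t a b e) (t a c d) (t a c e) (t a d e) (t b c d) (t b c e) (t b d e) (t c d e)
    where
    open xor-∧-Solver using (solve; _:+_; con; _:=_)
    t : (x y z : Fin n) → Bool
    t x y z = isEdge H ⟦ x ∷ y ∷ z ∷ [] ⟧

  link-complement-edge : ∀ {p q r u v} → Unique (p ∷ q ∷ r ∷ u ∷ v ∷ []) →
    ¬ Edge H ⟦ p ∷ u ∷ v ∷ [] ⟧ → ¬ Edge H ⟦ q ∷ u ∷ v ∷ [] ⟧ → ¬ Edge H ⟦ r ∷ u ∷ v ∷ [] ⟧ →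
    Edge H ⟦ p ∷ q ∷ r ∷ [] ⟧
  link-complement-edge {p} {q} {r} {u} {v} unique ¬puv ¬quv ¬ruv =
    decidable-stable (T? (isEdge H ⟦ p ∷ q ∷ r ∷ [] ⟧)) λ ¬pqr → contradiction
      (trans (sym (odd ¬pqr)) (quadParity-sum p q r u v)) λ ()
    where
    odd : ¬ Edge H ⟦ p ∷ q ∷ r ∷ [] ⟧ → parity (quadParities p q r u v) ≡ true
    odd ¬pqr
      -- The quadruples qruv, pruv, pquv, pqrv and pqru contain the non-edges ruv, ruv, quv, pqr and
      -- pqr respectively; five odd numbers have an odd sum.
      rewrite quad-odd (Unique-omit [] unique) (λ { (ruv ∷ _) → ¬ruv ruv })
            | quad-odd (Unique-omit (p ∷ []) unique) (λ { (ruv ∷ _) → ¬ruv ruv })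
            | quad-odd (Unique-omit (p ∷ q ∷ []) unique) (λ { (quv ∷ _) → ¬quv quv })
            | quad-odd (Unique-omit (p ∷ q ∷ r ∷ []) unique) (λ { (_ ∷ _ ∷ _ ∷ pqr ∷ []) → ¬pqr pqr })
            | quad-odd (Unique-omit (p ∷ q ∷ r ∷ u ∷ []) unique) (λ { (_ ∷ _ ∷ _ ∷ pqr ∷ []) → ¬pqr pqr })
      = refl

  opaque
    -- The set N(u,v) of the overview. Distinctness is demanded because repeated vertices give a set
    -- of fewer than three elements, which uniformity makes a non-edge. In particular the set is
    -- empty when `u` equals `v`.
    linkComplement : (u v : Fin n) → Subset n
    linkComplement u v = comprehension λ p →
      unique? (p ∷ u ∷ v ∷ []) ×-dec ¬? (T? (isEdge H ⟦ p ∷ u ∷ v ∷ [] ⟧))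
      where open DecUnique Fin._≟_ using (unique?)

    ∈-linkComplement⁺ : ∀ {p u v} → Unique (p ∷ u ∷ v ∷ []) →
      ¬ Edge H ⟦ p ∷ u ∷ v ∷ [] ⟧ → p ∈ linkComplement u v
    ∈-linkComplement⁺ unique ¬puv = ∈-comprehension⁺ _ (unique , ¬puv)

    ∈-linkComplement⁻ : ∀ {p u v} → p ∈ linkComplement u v →
      Unique (p ∷ u ∷ v ∷ []) × ¬ Edge H ⟦ p ∷ u ∷ v ∷ [] ⟧
    ∈-linkComplement⁻ = ∈-comprehension⁻ _

  linkComplement-clique : ∀ u v → IsClique H (linkComplement u v)
  linkComplement-clique u v e ∣e∣≡3 e⊆
    with p ∷ q ∷ r ∷ [] , refl , ((p≢q ∷ p≢r ∷ []) ∷ (q≢r ∷ []) ∷ [] ∷ []) , refl ← enumerate 3 e ∣e∣≡3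
    with (p≢u ∷ p≢v ∷ []) ∷ _ , ¬puv ← ∈-linkComplement⁻ (e⊆ (∈-⟦⟧⁺ (here refl)))
    with (q≢u ∷ q≢v ∷ []) ∷ _ , ¬quv ← ∈-linkComplement⁻ (e⊆ (∈-⟦⟧⁺ (there (here refl))))
    with (r≢u ∷ r≢v ∷ []) ∷ uv , ¬ruv ← ∈-linkComplement⁻ (e⊆ (∈-⟦⟧⁺ (there (there (here refl)))))
    = link-complement-edge
        ((p≢q ∷ p≢r ∷ p≢u ∷ p≢v ∷ []) ∷ (q≢r ∷ q≢u ∷ q≢v ∷ []) ∷ (r≢u ∷ r≢v ∷ []) ∷ uv) ¬puv ¬quv ¬ruv

  maximumClique-covers : ∀ {xs k} → IsMaximum (HasClique H) k → IsClique H ⟦ xs ⟧ → ∣ ⟦ xs ⟧ ∣ ≡ k →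
    ∀ x → x ∈ ⟦ xs ⟧ ∪ˢ ⋃ (map (uncurry linkComplement) (cartesianProduct xs xs))
  maximumClique-covers {xs} (_ , k-max) clique refl x with x ∈? ⟦ xs ⟧
  ... | yes x∈xs = x∈p∪q⁺ (inj₁ x∈xs)
  -- The set enlarged by `x` has one vertex more than a maximum clique, so it contains a non-edge
  -- `e`.
  ... | no x∉xs with e , ∣e∣≡3 , e⊆ , ¬edge ← ¬clique⇒nonEdge H (λ clique⁺ →
                       ℕ.1+n≰n (k-max _ (⟦ x ∷ xs ⟧ , clique⁺ , ∣⟦x∷xs⟧∣ x∉xs)))
    with x ∈? e
  ... | no x∉e = contradiction (clique e ∣e∣≡3 (⊆-omit [] x∉e e⊆)) ¬edge
  -- With `x` listed first, the other two vertices of `e` differ from `x` and so come from `xs`.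
  ... | yes x∈e with a ∷ b ∷ [] , refl , unique@((x≢a ∷ x≢b ∷ []) ∷ _) , refl ← enumerateFrom x∈e ∣e∣≡3 =
    x∈p∪q⁺ (inj₂ (∈-⋃⁺
      (∈-map⁺ (uncurry linkComplement) (∈-cartesianProduct⁺
        (old x≢a (there (here refl))) (old x≢b (there (there (here refl))))))
      (∈-linkComplement⁺ unique ¬edge)))
    where
    old : ∀ {y} → x ≢ y → y ∈ˡ x ∷ a ∷ b ∷ [] → y ∈ˡ xs
    old x≢y y∈ with ∈-⟦⟧⁻ (x ∷ xs) (e⊆ (∈-⟦⟧⁺ y∈))
    ... | here refl = contradiction refl x≢y
    ... | there y∈xs = y∈xs

  -- A maximum clique has `l ≤ k` vertices. Its `l * l` ordered pairs index the links, each of which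
  -- is a clique and so has at most `k` vertices.
  homogeneousNumber-bound : ∀ {k} → HomogeneousNumber H k → n ≤ k + k ℕ.* k ℕ.* k
  homogeneousNumber-bound {k} (_ , k-max)
    with l , l-max@((S , clique , ∣S∣≡l) , _) ← maximumClique H
    with xs , length≡ , _ , refl ← enumerate l S ∣S∣≡l = begin
      n ≡⟨ ∣⊤∣≡n n ⟨
      ∣ ⊤ {n} ∣ ≤⟨ p⊆q⇒∣p∣≤∣q∣ {p = ⊤} (λ {x} _ → maximumClique-covers l-max clique ∣S∣≡l x) ⟩
      ∣ ⟦ xs ⟧ ∪ˢ ⋃ links ∣ ≤⟨ ∣p∪q∣≤∣p∣+∣q∣ ⟦ xs ⟧ (⋃ links) ⟩
      ∣ ⟦ xs ⟧ ∣ + ∣ ⋃ links ∣ ≤⟨ ℕ.+-mono-≤ (clique≤k clique) (∣⋃∣≤ {ps = links} links≤k) ⟩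
      k + length links ℕ.* k ≡⟨ cong (λ m → k + m ℕ.* k) length-links ⟩
      k + l ℕ.* l ℕ.* k ≤⟨ ℕ.+-monoʳ-≤ k (ℕ.*-monoˡ-≤ k (ℕ.*-mono-≤ l≤k l≤k)) ⟩
      k + k ℕ.* k ℕ.* k ∎
    where
    open ℕ.≤-Reasoning
    links : List (Subset n)
    links = map (uncurry linkComplement) (cartesianProduct xs xs)
    clique≤k : ∀ {S} → IsClique H S → ∣ S ∣ ≤ k
    clique≤k {S} clique = k-max ∣ S ∣ (S , inj₁ clique , refl)
    l≤k : l ≤ k
    l≤k = subst (_≤ k) ∣S∣≡l (clique≤k clique)
    links≤k : All (λ p → ∣ p ∣ ≤ k) links
    links≤k = All.map⁺ (All.universal (λ (u , v) → clique≤k (linkComplement-clique u v))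
      (cartesianProduct xs xs))
    length-links : length links ≡ l ℕ.* l
    length-links = trans (List.length-map (uncurry linkComplement) (cartesianProduct xs xs))
      (trans (length-cartesianProduct xs xs) (cong₂ ℕ._*_ length≡ length≡))

-- Deciding which homogeneous numbers occur

glue : (f g : Subset n → Bool) → Subset (suc n) → Bool
glue f g (inside ∷ p) = f p
glue f g (outside ∷ p) = g p

-- Up to pointwise equality there are finitely many such functions; since pointwise equal functions
-- need not be propositionally equal, `P` is required to respect `≗`. A function on the subsets of
-- `suc n` points splits into two on the subsets of `n` points, according to the first point.
anyFunction? : ∀ n {P : Pred (Subset n → Bool) 0ℓ} →
  (∀ {f g} → f ≗ g → P f → P g) → Decidable P → Dec (∃ P)
anyFunction? zero {P} P-resp P? = map′
  (λ { (inj₁ Pt) → _ , Pt ; (inj₂ Pf) → _ , Pf })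
  (λ (f , Pf) → constant f Pf)
  (P? (λ _ → true) ⊎-dec P? (λ _ → false))
  where
  constant : ∀ f → P f → P (λ _ → true) ⊎ P (λ _ → false)
  constant f Pf with f [] in eq
  ... | true = inj₁ (P-resp (λ { [] → eq }) Pf)
  ... | false = inj₂ (P-resp (λ { [] → eq }) Pf)
anyFunction? (suc n) {P} P-resp P? = map′
  (λ (f , g , Pfg) → glue f g , Pfg)
  (λ (f , Pf) → f ∘ (inside ∷_) , f ∘ (outside ∷_) , P-resp (glue-split f) Pf)
  -- The outer search runs over the half for sets containing the first point, the inner one over the
  -- other half.
  (anyFunction? n (λ f≗f′ (g , Pfg) → g , P-resp (glue-cong f≗f′ λ _ → refl) Pfg) λ f →
   anyFunction? n (λ g≗g′ → P-resp (glue-cong (λ _ → refl) g≗g′)) λ g → P? (glue f g))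
  where
  glue-split : ∀ f → f ≗ glue (f ∘ (inside ∷_)) (f ∘ (outside ∷_))
  glue-split f (inside ∷ p) = refl
  glue-split f (outside ∷ p) = refl

  glue-cong : ∀ {f f′ g g′} → f ≗ f′ → g ≗ g′ → glue f g ≗ glue f′ g′
  glue-cong f≗f′ g≗g′ (inside ∷ p) = f≗f′ p
  glue-cong f≗f′ g≗g′ (outside ∷ p) = g≗g′ p

module _ (H H′ : Hypergraph r n) (eq : isEdge H ≗ isEdge H′) where

  Edge-resp : ∀ e → Edge H e → Edge H′ e
  Edge-resp e = subst T (eq e)

  Edge-resp⁻ : ∀ e → Edge H′ e → Edge H e
  Edge-resp⁻ e = subst T (sym (eq e))

  inducedEdges-cong : ∀ S → inducedEdges H S ≡ inducedEdges H′ S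
  inducedEdges-cong S = List.filter-≐ _ _
    ((λ {e} (edge , e⊆S) → Edge-resp e edge , λ {x} → e⊆S {x}) ,
     (λ {e} (edge , e⊆S) → Edge-resp⁻ e edge , λ {x} → e⊆S {x})) (subsets n)

  IsFree-resp : ∀ {m f} → IsFree H m f → IsFree H′ m f
  IsFree-resp free (S , ∣S∣≡m , len) = free (S , ∣S∣≡m , trans (cong length (inducedEdges-cong S)) len)

  HasHomogeneous-resp : ∀ {k} → HasHomogeneous H k → HasHomogeneous H′ k
  HasHomogeneous-resp (S , inj₁ clique , ∣S∣≡k) =
    S , inj₁ (λ e ∣e∣≡r e⊆S → Edge-resp e (clique e ∣e∣≡r e⊆S)) , ∣S∣≡k
  HasHomogeneous-resp (S , inj₂ coclique , ∣S∣≡k) =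
    S , inj₂ (λ e ∣e∣≡r e⊆S → coclique e ∣e∣≡r e⊆S ∘ Edge-resp⁻ e) , ∣S∣≡k

HomogeneousNumber-resp : ∀ (H H′ : Hypergraph r n) → isEdge H ≗ isEdge H′ →
  ∀ {k} → HomogeneousNumber H k → HomogeneousNumber H′ k
HomogeneousNumber-resp H H′ eq (has , largest) =
  HasHomogeneous-resp H H′ eq has ,
  λ j has′ → largest j (HasHomogeneous-resp H′ H (sym ∘ eq) has′)

isFree? : ∀ (H : Hypergraph r n) m f → Dec (IsFree H m f)
isFree? H m f = ¬? (anySubset? λ S → (∣ S ∣ ℕ.≟ m) ×-dec (length (inducedEdges H S) ℕ.≟ f))

-- The maximum exists and is unique, so it suffices to compare `k` with it.
homogeneousNumber? : ∀ (H : Hypergraph (suc r) n) → Decidable (HomogeneousNumber H)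
homogeneousNumber? H k with l , l-max ← homogeneousNumber H =
  map′ (λ { refl → l-max }) (λ k-max → maximum-unique k-max l-max) (k ℕ.≟ l)

Q : Pred (ℕ × ℕ) 0ℓ
Q = ｛ 4 , 0 ｝ ∪ ｛ 4 , 2 ｝

Attained : ∀ n → Pred ℕ 0ℓ
Attained n k = Σ (Hypergraph 3 n) λ H → IsQFree H Q × HomogeneousNumber H k

Q-free⁺ : ∀ {H : Hypergraph r n} → IsFree H 4 0 → IsFree H 4 2 → IsQFree H Q
Q-free⁺ free₀ free₂ _ _ (inj₁ refl) = free₀
Q-free⁺ free₀ free₂ _ _ (inj₂ refl) = free₂

Q-free⁻ : ∀ {H : Hypergraph r n} → IsQFree H Q → IsFree H 4 0 × IsFree H 4 2
Q-free⁻ free = free 4 0 (inj₁ refl) , free 4 2 (inj₂ refl)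

-- The minimum is found by testing values one at a time, which requires this decision. A hypergraph
-- is unpacked into its characteristic function and a uniformity proof, and the search runs over the
-- functions.
attained? : ∀ n → Decidable (Attained n)
attained? n k = map′
  (λ (f , u , free₀ , free₂ , num) → hyper f u , Q-free⁺ {H = hyper f u} free₀ free₂ , num)
  (λ (H , free , num) → isEdge H , uniform H , free 4 0 (inj₁ refl) , free 4 2 (inj₂ refl) , num)
  (anyFunction? n resp decide)
  where
  Uniform : Pred (Subset n → Bool) 0ℓ
  Uniform f = ∀ e → T (f e) → ∣ e ∣ ≡ 3

  hyper : ∀ f → Uniform f → Hypergraph 3 n
  hyper f u = record { isEdge = f ; uniform = u }

  P : Pred (Subset n → Bool) 0ℓ
  P f = Σ (Uniform f) λ u →
    IsFree (hyper f u) 4 0 × IsFree (hyper f u) 4 2 × HomogeneousNumber (hyper f u) k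

  resp : ∀ {f g} → f ≗ g → P f → P g
  resp {f} {g} f≗g (u , free₀ , free₂ , num) =
    u′ , IsFree-resp F G f≗g free₀ , IsFree-resp F G f≗g free₂ , HomogeneousNumber-resp F G f≗g num
    where
    u′ : Uniform g
    u′ e edge = u e (subst T (sym (f≗g e)) edge)
    F G : Hypergraph 3 n
    F = hyper f u
    G = hyper g u′

  decide : Decidable P
  decide f with allSubsets? (λ e → T? (f e) →-dec (∣ e ∣ ℕ.≟ 3))
  ... | no ¬u = no (¬u ∘ proj₁)
  -- The remaining conditions depend on the edge function alone, so a witness with another
  -- uniformity proof also serves for `u`.
  ... | yes u = map′ (u ,_) proj₂
    (isFree? (hyper f u) 4 0 ×-dec isFree? (hyper f u) 4 2 ×-dec homogeneousNumber? (hyper f u) k)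

-- The complete 3-graph and existence of the minimum

complete : ∀ r n → Hypergraph r n
complete r n = record
  { isEdge = λ e → ⌊ ∣ e ∣ ℕ.≟ r ⌋
  ; uniform = λ e → toWitness
  }

complete-quad : ∀ (S : Subset n) → ∣ S ∣ ≡ 4 → length (inducedEdges (complete 3 n) S) ≡ 4
complete-quad {n} S ∣S∣≡4 with a ∷ b ∷ c ∷ d ∷ [] , refl , unique , refl ← enumerate 4 S ∣S∣≡4 =
  trans (length-inducedEdges unique (complete 3 n))
    (cong length (List.filter-all (T? ∘ isEdge (complete 3 n))
      (All.tabulate λ e∈ → fromWitness (proj₁ (∈-triples⁻ unique e∈)))))

complete-free : ∀ {f} → f ≢ 4 → IsFree (complete 3 n) 4 f
complete-free f≢4 (S , ∣S∣≡4 , len) = f≢4 (trans (sym len) (complete-quad S ∣S∣≡4))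

-- In the complete 3-graph every four vertices span 4 edges, so it is Q-free; its homogeneous number
-- bounds the upward search for the least attained value.
minHomogeneousNumber : ∀ n → ∃ (MinHomogeneousNumber 3 n Q)
minHomogeneousNumber n with k , k-max ← homogeneousNumber (complete 3 n) =
  minimum (attained? n) k
    (complete 3 n , Q-free⁺ {H = complete 3 n} (complete-free λ ()) (complete-free λ ()) , k-max)

-- The rational inequality

open Algebra.Definitions.RawSemiring ℚ.+-*-rawSemiring using () renaming (_^_ to _^ℚ_)

-- The equation is checked on unnormalised fractions, where both denominators are 1 and no reduction
-- to lowest terms intervenes.
fromℕ-homo-* : ∀ m n → fromℕ (m ℕ.* n) ≡ fromℕ m ℚ.* fromℕ n
fromℕ-homo-* m n = ℚ.toℚᵘ-injective (begin-equality
  toℚᵘ (fromℕ (m ℕ.* n)) ≃⟨ ℚ.toℚᵘ-fromℚᵘ (mkℚᵘ (ℤ.+ (m ℕ.* n)) 0) ⟩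
  mkℚᵘ (ℤ.+ (m ℕ.* n)) 0 ≡⟨ cong (λ i → mkℚᵘ i 0) (ℤ.pos-* m n) ⟩
  mkℚᵘ (ℤ.+ m) 0 ℚᵘ.* mkℚᵘ (ℤ.+ n) 0
    ≃⟨ ℚᵘ.*-cong (ℚ.toℚᵘ-fromℚᵘ (mkℚᵘ (ℤ.+ m) 0)) (ℚ.toℚᵘ-fromℚᵘ (mkℚᵘ (ℤ.+ n) 0)) ⟨
  toℚᵘ (fromℕ m) ℚᵘ.* toℚᵘ (fromℕ n) ≃⟨ ℚ.toℚᵘ-homo-* (fromℕ m) (fromℕ n) ⟨
  toℚᵘ (fromℕ m ℚ.* fromℕ n) ∎)
  where open ℚᵘ.≤-Reasoning

fromℕ-homo-^ : ∀ m k → fromℕ (m ^ k) ≡ fromℕ m ^ℚ k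
fromℕ-homo-^ m zero = refl
fromℕ-homo-^ m (suc k) = trans (fromℕ-homo-* m (m ^ k)) (cong (fromℕ m ℚ.*_) (fromℕ-homo-^ m k))

fromℕ-mono-< : ∀ {m n} → m ℕ.< n → fromℕ m < fromℕ n
fromℕ-mono-< {m} {n} m<n = ℚ.toℚᵘ-cancel-< (begin-strict
  toℚᵘ (fromℕ m) ≃⟨ ℚ.toℚᵘ-fromℚᵘ (mkℚᵘ (ℤ.+ m) 0) ⟩
  mkℚᵘ (ℤ.+ m) 0 <⟨ *<* (ℤ.*-monoʳ-<-pos (ℤ.+ 1) (ℤ.+<+ m<n)) ⟩
  mkℚᵘ (ℤ.+ n) 0 ≃⟨ ℚ.toℚᵘ-fromℚᵘ (mkℚᵘ (ℤ.+ n) 0) ⟨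
  toℚᵘ (fromℕ n) ∎)
  where open ℚᵘ.≤-Reasoning

k+k³≤2k⁵ : ∀ k → k + k ℕ.* k ℕ.* k ≤ 2 ℕ.* k ^ 5
k+k³≤2k⁵ zero = z≤n
-- A positive base makes the powers monotone in the exponent.
k+k³≤2k⁵ k@(suc _) = begin
  k + k ℕ.* k ℕ.* k ≡⟨ cong₂ _+_ (ℕ.^-identityʳ k) k³ ⟨
  k ^ 1 + k ^ 3
    ≤⟨ ℕ.+-mono-≤ (ℕ.^-monoʳ-≤ k {1} {5} (s≤s z≤n)) (ℕ.^-monoʳ-≤ k {3} {5} (s≤s (s≤s (s≤s z≤n)))) ⟩
  k ^ 5 + k ^ 5 ≡⟨ cong ((k ^ 5) +_) (ℕ.+-identityʳ (k ^ 5)) ⟨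
  2 ℕ.* k ^ 5 ∎
  where
  open ℕ.≤-Reasoning
  k³ : k ^ 3 ≡ k ℕ.* k ℕ.* k
  k³ = trans (cong (λ m → k ℕ.* (k ℕ.* m)) (ℕ.*-identityʳ k)) (sym (ℕ.*-assoc k k k))

-- The fifth power of ½ is 1/32, so the claim amounts to n < 32 k⁵.
½·⁵√≺ : ∀ n k → n ℕ.> 0 → n ≤ k + k ℕ.* k ℕ.* k → ½ ·⁵√ n ≺ k
½·⁵√≺ n k n>0 n≤ = begin-strict
  ½ ^ℚ 5 ℚ.* fromℕ n <⟨ ℚ.*-monoʳ-<-pos (½ ^ℚ 5) (fromℕ-mono-< n<32k⁵) ⟩
  ½ ^ℚ 5 ℚ.* fromℕ (32 ℕ.* k ^ 5) ≡⟨ cong ((½ ^ℚ 5) ℚ.*_) (fromℕ-homo-* 32 (k ^ 5)) ⟩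
  ½ ^ℚ 5 ℚ.* (fromℕ 32 ℚ.* fromℕ (k ^ 5)) ≡⟨ ℚ.*-assoc (½ ^ℚ 5) (fromℕ 32) (fromℕ (k ^ 5)) ⟨
  -- The product of the two constants evaluates to 1.
  ½ ^ℚ 5 ℚ.* fromℕ 32 ℚ.* fromℕ (k ^ 5) ≡⟨ ℚ.*-identityˡ (fromℕ (k ^ 5)) ⟩
  fromℕ (k ^ 5) ≡⟨ fromℕ-homo-^ k 5 ⟩
  fromℕ k ^ℚ 5 ∎
  where
  open ℚ.≤-Reasoning
  n≤2k⁵ : n ≤ 2 ℕ.* k ^ 5
  n≤2k⁵ = ℕ.≤-trans n≤ (k+k³≤2k⁵ k)
  n<32k⁵ : n ℕ.< 32 ℕ.* k ^ 5
  -- Strictness comes from n < 16 n for positive n; then 16 n ≤ 16 · 2 k⁵.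
  n<32k⁵ = ℕ.<-≤-trans
    (ℕ.m<m*n n 16 {{ℕ.>-nonZero n>0}} (s≤s (s≤s z≤n)))
    (ℕ.≤-trans (ℕ.*-monoˡ-≤ 16 n≤2k⁵)
      (ℕ.≤-reflexive (trans (ℕ.*-comm (2 ℕ.* k ^ 5) 16) (sym (ℕ.*-assoc 16 2 (k ^ 5))))))

mainTheorem4 : ∃[ c₁ ] (0ℚ < c₁ ×
    (∀ n → n > 5 →
    ∃[ k ] (MinHomogeneousNumber 3 n (｛ 4 , 0 ｝ ∪ ｛ 4 , 2 ｝) k × c₁ ·⁵√ n ≺ k)))
mainTheorem4 = ½ , ℚ.positive⁻¹ ½ , λ n n>5 → bound n n>5 (minHomogeneousNumber n)
  where
  bound : ∀ n → n > 5 → ∃ (MinHomogeneousNumber 3 n Q) →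
    ∃[ k ] (MinHomogeneousNumber 3 n Q k × ½ ·⁵√ n ≺ k)
  bound n n>5 (k , k-min@((H , free , num) , _)) with free₀ , free₂ ← Q-free⁻ {H = H} free =
    k , k-min , ½·⁵√≺ n k (ℕ.≤-trans (s≤s z≤n) n>5) (homogeneousNumber-bound H free₀ free₂ num)
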